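{- For all $n\ge 1$, the pairs of statistics $(\mathrm{des},\mathrm{drops})$ and $(\mathrm{exc},\mathrm{dp})$ are equidistributed over $\mathfrak{S}_n$; that is, $$\sum_{w \in \mathfrak{S}_n} q^{\mathrm{drops}(w)} t^{\mathrm{des}(w)} = \sum_{w \in \mathfrak{S}_n} q^{\mathrm{dp}(w)} t^{\mathrm{exc}(w)}$$ as polynomials in $q,t$. In particular, for every $k$, $$|\{ w \in \mathfrak{S}_n : \mathrm{dp}(w) =k \}| = |\{ w \in \mathfrak{S}_n : \mathrm{drops}(w) = k\}|.$$
   Context: $\mathfrak{S}_n$ is the group of permutations of $\{1,\dots,n\}$. For $w\in\mathfrak{S}_n$: $\mathrm{des}(w)=|\{i : 1\le i\le n-1,\ w(i)>w(i+1)\}|$ (descent number); $\mathrm{exc}(w)=|\{i : w(i)>i\}|$ (excedance number); $\mathrm{drops}(w)=\sum_{1\le i\le n-1,\ w(i)>w(i+1)}(w(i)-w(i+1))$ (descent drop). For $1\le i<j\le n$, $t_{ij}$ denotes the transposition interchanging $i$ and $j$; its depth is $j-i$. The depth of $w$ is $$\mathrm{dp}(w)=\min\Big\{\sum_{r=1}^k (j_r-i_r) : k\ge 0,\ w=t_{i_1j_1}\cdots t_{i_kj_k},\ i_r<j_r\Big\}.$$ -}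

module Defs where

open import Data.Bool.Base using (if_then_else_)
open import Data.Fin.Base as Fin using (Fin; zero; suc; toℕ; inject₁; punchIn)
open import Data.Fin.Permutation using (id; Permutation′; _⟨$⟩ʳ_; _≈_; insert; remove; insert-remove)
open import Data.Fin.Permutation.Transposition.List using (TranspositionList; eval; decompose; eval-decompose)
import Data.Fin.Permutation.Components as PC
import Data.Fin.Properties as Fin
open import Data.List.Base using (List; []; _∷_; map; foldr; filter; length; allFin; cartesianProductWith; cartesianProduct)
open import Data.List.Membership.Propositional using (_∈_; lose; find)
open import Data.List.Membership.Propositional.Properties using (∈-allFin; ∈-cartesianProduct⁺; ∈-cartesianProductWith⁺)
import Data.List.Membership.Setoid as SetoidMembership
import Data.List.Membership.Setoid.Properties as SetoidMembershipₚ
open import Data.List.Relation.Unary.All as All using (All; []; _∷_)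
open import Data.List.Relation.Unary.AllPairs using ([]; _∷_)
open import Data.List.Relation.Unary.Any as Any using (here; there)
import Data.List.Relation.Unary.Unique.Setoid as SetoidUnique
import Data.List.Relation.Unary.Unique.Setoid.Properties as SetoidUniqueₚ
open import Data.List.Relation.Unary.Unique.Propositional.Properties using (allFin⁺)
open import Data.Nat.Base using (ℕ; zero; suc; _+_; _∸_; _⊔_; _≤_; _<_; z≤n; s≤s)
open import Data.Nat.ListAction using (sum)
import Data.Nat.Properties as ℕ
open import Data.Nat.Induction using (<-rec)
open import Data.Product.Base using (∃; ∃-syntax; _×_; _,_; proj₁; proj₂)
open import Level using (0ℓ)
open import Relation.Binary.Bundles using (Setoid)
open import Relation.Binary.Definitions using (tri<; tri≈; tri>)
open import Relation.Binary.PropositionalEquality using (_≡_; refl; sym; trans; cong; cong₂; setoid)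
open import Relation.Nullary using (yes; no; contradiction)
open import Relation.Nullary.Decidable using (⌊_⌋; dec-true; dec-false; _×-dec_; map′)
open import Relation.Unary using (Pred; Decidable)

private
  variable
    n : ℕ

-- {1,…,n} is modelled by Fin n (values shifted down by one); descents,
-- excedances and differences do not depend on the shift.

permutationSetoid : ℕ → Setoid 0ℓ 0ℓ
permutationSetoid n = record
  { Carrier       = Permutation′ n
  ; _≈_           = _≈_
  ; isEquivalence = record
    { refl  = λ _ → refl
    ; sym   = λ p i → sym (p i)
    ; trans = λ p q i → trans (p i) (q i)
    }
  }

-- Every permutation occurs exactly once up to _≈_: see 𝔖-complete and
-- 𝔖-unique.
𝔖 : ∀ n → List (Permutation′ n)
𝔖 zero    = id ∷ []
𝔖 (suc n) = cartesianProductWith (insert zero) (allFin (suc n)) (𝔖 n)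

module _ {n : ℕ} where
  open SetoidMembership (permutationSetoid n) public using () renaming (_∈_ to _∈ₚ_)
  open SetoidUnique (permutationSetoid n) public using () renaming (Unique to Uniqueₚ)

insert-cong : ∀ {i j : Fin (suc n)} {π ρ : Permutation′ n} →
              i ≡ j → π ≈ ρ → insert zero i π ≈ insert zero j ρ
insert-cong         refl p zero    = refl
insert-cong {i = i} refl p (suc k) = cong (punchIn i) (p k)

insert-injective : ∀ {i j : Fin (suc n)} {π ρ : Permutation′ n} →
                   insert zero i π ≈ insert zero j ρ → i ≡ j × π ≈ ρ
insert-injective {i = i} p with refl ← p zero =
  refl , λ k → Fin.punchIn-injective i _ _ (p (suc k))

𝔖-complete : (w : Permutation′ n) → w ∈ₚ 𝔖 n
𝔖-complete {zero}  w = here λ ()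
𝔖-complete {suc n} w = SetoidMembershipₚ.∈-resp-≈ (permutationSetoid (suc n))
  {𝔖 (suc n)} {insert zero (w ⟨$⟩ʳ zero) (remove zero w)} {w}
  (insert-remove zero w)
  (SetoidMembershipₚ.∈-cartesianProductWith⁺
    (setoid (Fin (suc n))) (permutationSetoid n) (permutationSetoid (suc n))
    (λ {i} {j} {π} {ρ} → insert-cong {i = i} {j} {π} {ρ})
    (∈-allFin (w ⟨$⟩ʳ zero)) (𝔖-complete (remove zero w)))

𝔖-unique : ∀ n → Uniqueₚ (𝔖 n)
𝔖-unique zero    = [] ∷ []
𝔖-unique (suc n) = SetoidUniqueₚ.cartesianProductWith⁺
  (setoid (Fin (suc n))) (permutationSetoid n) (permutationSetoid (suc n))
  (insert zero)
  (λ {i} {j} {π} {ρ} → insert-injective {i = i} {j} {π} {ρ})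
  (allFin⁺ (suc n)) (𝔖-unique n)

consecutive : ∀ n → List (Fin n × Fin n)
consecutive zero    = []
consecutive (suc m) = map (λ i → inject₁ i , suc i) (allFin m)

descents : Permutation′ n → List (Fin n × Fin n)
descents {n} w = filter (λ (i , i⁺) → (w ⟨$⟩ʳ i⁺) Fin.<? (w ⟨$⟩ʳ i)) (consecutive n)

des : Permutation′ n → ℕ
des w = length (descents w)

drops : Permutation′ n → ℕ
drops w = sum (map (λ (i , i⁺) → toℕ (w ⟨$⟩ʳ i) ∸ toℕ (w ⟨$⟩ʳ i⁺)) (descents w))

exc : Permutation′ n → ℕ
exc {n} w = length (filter (λ i → i Fin.<? (w ⟨$⟩ʳ i)) (allFin n))

Increasing : Pred (TranspositionList n) 0ℓ
Increasing = All (λ (i , j) → i Fin.< j)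

totalDepth : TranspositionList n → ℕ
totalDepth ts = sum (map (λ (i , j) → toℕ j ∸ toℕ i) ts)

-- eval multiplies from left to right (the first transposition acts first).
-- Reading the word in the other direction changes neither the total depth
-- nor Increasing, so the opposite convention gives the same set of values.
FactorsWithDepth : Permutation′ n → Pred ℕ 0ℓ
FactorsWithDepth w d = ∃[ ts ] Increasing ts × w ≈ eval ts × totalDepth ts ≡ d

IsMinimum : Pred ℕ 0ℓ → Pred ℕ 0ℓ
IsMinimum P m = P m × (∀ k → P k → m ≤ k)

private

  minimum : {P : Pred ℕ 0ℓ} → Decidable P → ∃ P → ∃ (IsMinimum P)
  minimum {P} P? (m , Pm) = <-rec (λ m → P m → ∃ (IsMinimum P)) step m Pm
    where
    step : ∀ m → (∀ {k} → k < m → P k → ∃ (IsMinimum P)) → P m → ∃ (IsMinimum P)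
    step m rec Pm with ℕ.anyUpTo? P? m
    ... | yes (k , k<m , Pk) = rec k<m Pk
    ... | no  none           =
      m , Pm , λ k Pk → ℕ.≮⇒≥ λ k<m → none (k , k<m , Pk)

  words : ∀ n → ℕ → List (TranspositionList n)
  words n zero    = [] ∷ []
  words n (suc l) = [] ∷ cartesianProductWith _∷_ (cartesianProduct (allFin n) (allFin n)) (words n l)

  ∈-words : ∀ l (ts : TranspositionList n) → length ts ≤ l → ts ∈ words n l
  ∈-words zero    []             _         = here refl
  ∈-words (suc l) []             _         = here refl
  ∈-words (suc l) ((i , j) ∷ ts) (s≤s len) = there
    (∈-cartesianProductWith⁺ _∷_ (∈-cartesianProduct⁺ (∈-allFin i) (∈-allFin j)) (∈-words l ts len))

  length≤totalDepth : (ts : TranspositionList n) → Increasing ts → length ts ≤ totalDepth ts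
  length≤totalDepth []       []         = z≤n
  length≤totalDepth (_ ∷ ts) (i<j ∷ inc) = ℕ.+-mono-≤ (ℕ.m<n⇒0<n∸m i<j) (length≤totalDepth ts inc)

  factorsWithDepth? : (w : Permutation′ n) → Decidable (FactorsWithDepth w)
  factorsWithDepth? {n} w d = map′
    (λ p → let ts , _ , q = find p in ts , q)
    (λ { (ts , inc , eq , refl) →
       lose (∈-words d ts (length≤totalDepth ts inc)) (inc , eq , refl) })
    (Any.any? (λ ts → All.all? (λ (i , j) → i Fin.<? j) ts
                      ×-dec Fin.all? (λ k → (w ⟨$⟩ʳ k) Fin.≟ (eval ts ⟨$⟩ʳ k))
                      ×-dec totalDepth ts ℕ.≟ d)
              (words n d))

  transpose-comm : ∀ (i j k : Fin n) → PC.transpose i j k ≡ PC.transpose j i k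
  transpose-comm i j k with k Fin.≟ i | k Fin.≟ j
  ... | yes k≡i | yes k≡j = trans (sym k≡j) k≡i
  ... | yes k≡i | no _    rewrite dec-true (k Fin.≟ i) k≡i = refl
  ... | no _    | yes k≡j rewrite dec-true (k Fin.≟ j) k≡j = refl
  ... | no k≢i  | no k≢j  rewrite dec-false (k Fin.≟ i) k≢i | dec-false (k Fin.≟ j) k≢j = refl

  transpose-same : ∀ (i k : Fin n) → PC.transpose i i k ≡ k
  transpose-same i k with k Fin.≟ i
  ... | yes k≡i = sym k≡i
  ... | no k≢i rewrite dec-false (k Fin.≟ i) k≢i = refl

  increasing : (ts : TranspositionList n) → ∃[ us ] Increasing us × eval ts ≈ eval us
  increasing []             = [] , [] , λ _ → refl
  increasing ((i , j) ∷ ts) with us , inc , eq ← increasing ts | Fin.<-cmp i j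
  ... | tri< i<j _ _ = (i , j) ∷ us , i<j ∷ inc , λ k → eq _
  ... | tri≈ _ refl _ = us , inc , λ k → trans (eq _) (cong (eval us ⟨$⟩ʳ_) (transpose-same i k))
  ... | tri> _ _ j<i = (j , i) ∷ us , j<i ∷ inc , λ k →
    trans (eq _) (cong (eval us ⟨$⟩ʳ_) (transpose-comm i j k))

-- Abstract so that the search never runs during type checking; dp is
-- determined by dp-isMinimum.
abstract
  depth : (w : Permutation′ n) → ∃ (IsMinimum (FactorsWithDepth w))
  depth w = minimum (factorsWithDepth? w)
    (let us , inc , eq = increasing (decompose w)
     in totalDepth us , us , inc , (λ k → trans (sym (eval-decompose w k)) (eq k)) , refl)

dp : Permutation′ n → ℕ
dp w = proj₁ (depth w)

dp-isMinimum : (w : Permutation′ n) → IsMinimum (FactorsWithDepth w) (dp w)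
dp-isMinimum w = proj₂ (depth w)

-- ℕ[q,t]: coeff a b is the coefficient of q^a t^b.
record Polynomial : Set where
  field
    coeff : ℕ → ℕ → ℕ
    bound : ℕ
    zero-above : ∀ a b → bound < a + b → coeff a b ≡ 0

open Polynomial public

infix 4 _≈ₚ_
_≈ₚ_ : Polynomial → Polynomial → Set
p ≈ₚ r = ∀ a b → coeff p a b ≡ coeff r a b

0ₚ : Polynomial
0ₚ = record { coeff = λ _ _ → 0 ; bound = 0 ; zero-above = λ _ _ _ → refl }

infixl 6 _+ₚ_
_+ₚ_ : Polynomial → Polynomial → Polynomial
p +ₚ r = record
  { coeff      = λ a b → coeff p a b + coeff r a b
  ; bound      = bound p ⊔ bound r
  ; zero-above = λ a b lt → cong₂ _+_
      (zero-above p a b (ℕ.≤-<-trans (ℕ.m≤m⊔n (bound p) (bound r)) lt))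
      (zero-above r a b (ℕ.≤-<-trans (ℕ.m≤n⊔m (bound p) (bound r)) lt))
  }

infix 8 q^_t^_
q^_t^_ : ℕ → ℕ → Polynomial
q^ c t^ d = record
  { coeff      = λ a b → if ⌊ (a ℕ.≟ c) ×-dec (b ℕ.≟ d) ⌋ then 1 else 0
  ; bound      = c + d
  ; zero-above = vanish
  }
  where
  vanish : ∀ a b → c + d < a + b →
           (if ⌊ (a ℕ.≟ c) ×-dec (b ℕ.≟ d) ⌋ then 1 else 0) ≡ 0
  vanish a b lt with (a ℕ.≟ c) ×-dec (b ℕ.≟ d)
  ... | yes (refl , refl) = contradiction lt (ℕ.<-irrefl refl)
  ... | no  _             = refl

infix 5 ∑-syntax
∑-syntax : {A : Set} → List A → (A → Polynomial) → Polynomial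
∑-syntax xs f = foldr (λ x p → f x +ₚ p) 0ₚ xs

syntax ∑-syntax xs (λ x → e) = ∑[ x ∈ xs ] e

{-# OPTIONS --safe #-}

-- Attach to each letter a of w two numbers: the word gap a ∸ b, where b is the letter
-- after a in the word of w (gap 0 if a is last), and the cycle gap a ∸ w⁻¹(a); both are
-- truncated at 0.  The pairs (drops, des)
-- and (Σ max(w(i) − i, 0), exc) are the sum and the number of nonzero entries of
-- these two vectors.  A permutation of n + 1 letters arises uniquely by raising all
-- letters of some π by one and inserting 0, either into the word or into the cycles
-- of π.  In both cases the gap vector gets a new entry 0 in front, and then either
-- is left alone or one entry, at position c ≥ 1 say, is replaced by c.  So by
-- induction the two gap vectors are equidistributed.
--
-- It remains to see that dp(w) = Σ max(w(i) − i, 0).  Multiplying by t_ij changes this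
-- sum by at most j − i, which gives ≥.  For ≤, inserting 0 into the cycle of
-- a = c − 1 multiplies the raised π by the transposition (0 c) on one side, or
-- equally by (0 p+1) on the other, where p = π⁻¹(a); the sum grows by exactly
-- min(p, a) + 1, the depth of the cheaper of the two.
module Submission where

open import Defs
open import Data.Nat using (ℕ; _≥_; _≟_)
open import Data.List using (length; filter)
open import Data.Product using (_×_)
open import Relation.Binary.PropositionalEquality using (_≡_)

open import Data.Bool.Base using (if_then_else_)
open import Data.Fin.Base as Fin using (Fin; zero; suc; toℕ; inject₁; punchIn)
open import Data.Fin.Permutation
  using (Permutation′; _⟨$⟩ʳ_; _⟨$⟩ˡ_; _≈_; _∘ₚ_; flip; inverseˡ; inverseʳ; transpose; lift₀;
         lift₀-cong; lift₀-remove; insert; insert-punchIn; insert-remove; remove)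
import Data.Fin.Permutation.Components as PC
open import Data.Fin.Permutation.Transposition.List as TL using (TranspositionList; eval; eval-lift)
import Data.Fin.Properties as Fin
open import Data.List.Base using (List; []; _∷_; _++_; map; tabulate; allFin; cartesianProductWith)
open import Data.List.Membership.Propositional.Properties using (∈-allFin)
import Data.List.Membership.Setoid.Properties as SetoidMembershipₚ
open import Data.List.Properties using (map-++; map-∘; map-cong)
open import Data.List.Relation.Binary.Permutation.Propositional
  using (_↭_; ↭-refl; ↭ₛ⇒↭; module PermutationReasoning)
import Data.List.Relation.Binary.Permutation.Propositional.Properties as ↭
import Data.List.Relation.Binary.Permutation.Setoid as SetoidPermutation
import Data.List.Relation.Binary.Permutation.Setoid.Properties as SetoidPermutationₚ
import Data.List.Relation.Binary.Subset.Setoid as SetoidSubset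
open import Data.List.Relation.Unary.All as All using ([]; _∷_)
import Data.List.Relation.Unary.All.Properties as All
open import Data.List.Relation.Unary.AllPairs using ([]; _∷_)
open import Data.List.Relation.Unary.Any using (here; there)
import Data.List.Relation.Unary.Unique.Setoid as SetoidUnique
import Data.List.Relation.Unary.Unique.Setoid.Properties as SetoidUniqueₚ
open import Data.List.Relation.Unary.Unique.Propositional.Properties using (allFin⁺)
open import Data.Nat.Base using (suc; zero; _+_; _∸_; _⊓_; _≤_; _<_; z≤n; s<s; z<s)
import Data.Nat.ListAction as List
import Data.Nat.ListAction.Properties as List
import Data.Nat.Properties as ℕ
open import Data.Product using (∃; ∃₂; _,_; proj₁)
open import Data.Vec.Base as Vec using (Vec; _∷_; lookup; _[_]≔_)
open import Data.Vec.Properties using (lookup∘tabulate; tabulate∘lookup; tabulate-cong; lookup∘update; lookup∘update′)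
open import Function.Base using (_∘_; case_of_)
open import Level using (0ℓ)
open import Relation.Binary.Bundles using (Setoid)
open import Relation.Binary.PropositionalEquality
  using (_≢_; _≗_; refl; sym; trans; cong; cong₂; subst; setoid; module ≡-Reasoning)
open import Relation.Nullary using (¬_; does; yes; no; contradiction)
open import Relation.Nullary.Decidable using (dec-true; dec-false)
open import Relation.Unary using (Pred; Decidable)

open import Algebra.Properties.CommutativeMonoid.Sum ℕ.+-0-commutativeMonoid
  using (sum; sum-cong-≗; sum-replicate-zero; ∑-distrib-+; sum-remove; sum-permute)

private
  variable
    n : ℕ
    A B C : Set

-- Rearrangements of lists: without repetition over a setoid, and in products.

module _ (S : Setoid 0ℓ 0ℓ) where
  open Setoid S using () renaming (sym to ≈-sym; refl to ≈-refl)
  open SetoidSubset S using (_⊆_)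
  open SetoidUnique S using (Unique)
  open SetoidPermutation S using (↭-prep)
    renaming (_↭_ to _↭ₛ_; ↭-sym to ↭ₛ-sym; ↭-trans to ↭ₛ-trans; ↭-refl to ↭ₛ-refl;
              ↭-reflexive-≋ to ↭ₛ-reflexive-≋)
  open SetoidPermutationₚ S using (shift; ∈-resp-↭; Unique-resp-↭)

  private
    ⊆-tail : ∀ {x xs ys} → Unique (x ∷ xs) → (x ∷ xs) ⊆ (x ∷ ys) → xs ⊆ ys
    ⊆-tail (x∉xs ∷ _) sub v∈xs with sub (there v∈xs)
    ... | here v≈x   = contradiction (SetoidMembershipₚ.∈-resp-≈ S v≈x v∈xs)
                                     (SetoidMembershipₚ.All[≉]⇒∉ S x∉xs)
    ... | there v∈ys = v∈ys

  -- Needed over a setoid because permutations are enumerated only up to `_≈_`. The head of the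
  -- first list is located in the second and moved to the front; absence of repetitions then allows
  -- it to be removed from both inclusions.
  unique∧⊆∧⊇⇒↭ : ∀ {xs ys} → Unique xs → Unique ys → xs ⊆ ys → ys ⊆ xs → xs ↭ₛ ys
  unique∧⊆∧⊇⇒↭ {[]}     {[]}     _  _ _ _   = ↭ₛ-refl
  unique∧⊆∧⊇⇒↭ {[]}     {y ∷ ys} _  _ _ sup with () ← sup (here ≈-refl)
  unique∧⊆∧⊇⇒↭ {x ∷ xs} {ys}     x∷xs!@(_ ∷ xs!) ys! sub sup
    with as , bs , w , x≈w , ys≋ ← SetoidMembershipₚ.∈-∃++ S (sub (here ≈-refl))
    = ↭ₛ-trans (↭-prep x (unique∧⊆∧⊇⇒↭ xs! zs!
        (⊆-tail x∷xs! (∈-resp-↭ ys↭x∷zs ∘ sub))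
        (⊆-tail x∷zs! (sup ∘ ∈-resp-↭ (↭ₛ-sym ys↭x∷zs)))))
      (↭ₛ-sym ys↭x∷zs)
    where
    ys↭x∷zs : ys ↭ₛ (x ∷ as ++ bs)
    ys↭x∷zs = ↭ₛ-trans (↭ₛ-reflexive-≋ ys≋) (shift (≈-sym x≈w) as bs)
    x∷zs! : Unique (x ∷ as ++ bs)
    x∷zs! = Unique-resp-↭ ys↭x∷zs ys!
    zs! : Unique (as ++ bs)
    zs! = case x∷zs! of λ { (_ ∷ u) → u }

map-cartesianProductWith : ∀ {D E : Set} {f : A → B → C} {g : C → D} {h : B → E} {k : A → E → D} →
  (∀ a b → g (f a b) ≡ k a (h b)) → ∀ xs ys →
  map g (cartesianProductWith f xs ys) ≡ cartesianProductWith k xs (map h ys)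
map-cartesianProductWith eq []       ys = refl
map-cartesianProductWith {f = f} {g} {h} {k} eq (x ∷ xs) ys = begin
  map g (map (f x) ys ++ cartesianProductWith f xs ys)             ≡⟨ map-++ g (map (f x) ys) _ ⟩
  map g (map (f x) ys) ++ map g (cartesianProductWith f xs ys)     ≡⟨ cong₂ _++_ row (map-cartesianProductWith eq xs ys) ⟩
  map (k x) (map h ys) ++ cartesianProductWith k xs (map h ys)     ∎
  where
  open ≡-Reasoning
  row : map g (map (f x) ys) ≡ map (k x) (map h ys)
  row = begin
    map g (map (f x) ys) ≡⟨ map-∘ ys ⟨
    map (g ∘ f x) ys     ≡⟨ map-cong (eq x) ys ⟩
    map (k x ∘ h) ys     ≡⟨ map-∘ ys ⟩
    map (k x) (map h ys) ∎

cartesianProductWith-↭ʳ : ∀ (f : A → B → C) xs {ys zs} → ys ↭ zs →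
  cartesianProductWith f xs ys ↭ cartesianProductWith f xs zs
cartesianProductWith-↭ʳ f []       p = ↭-refl
cartesianProductWith-↭ʳ f (x ∷ xs) p = ↭.++⁺ (↭.map⁺ (f x) p) (cartesianProductWith-↭ʳ f xs p)

-- Enumerating the symmetric group by insertions.

-- Up to `_≈_`, pairs of a label `c` and a permutation of n points correspond bijectively to
-- permutations of n + 1 points.
record IsInsertion (ins : Fin (suc n) → Permutation′ n → Permutation′ (suc n)) : Set where
  field
    ins-cong       : ∀ {c π ρ} → π ≈ ρ → ins c π ≈ ins c ρ
    ins-injective  : ∀ {c d π ρ} → ins c π ≈ ins d ρ → c ≡ d × π ≈ ρ
    ins-surjective : ∀ w → ∃₂ λ c π → ins c π ≈ w

-- Both underlying lists contain every permutation exactly once up to `_≈_`, so any insertion may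
-- replace the one that defines `𝔖`. As `g` respects `_≈_`, the images are rearrangements up to
-- propositional equality.
map-𝔖-suc : ∀ {ins} → IsInsertion {n} ins → {g : Permutation′ (suc n) → A} →
  (∀ {v w} → v ≈ w → g v ≡ g w) →
  map g (𝔖 (suc n)) ↭ map g (cartesianProductWith ins (allFin (suc n)) (𝔖 n))
map-𝔖-suc {n} {A} {ins} isIns {g} g-cong = ↭ₛ⇒↭
  (SetoidPermutationₚ.map⁺ (permutationSetoid (suc n)) (setoid A) (λ {v} {w} → g-cong {v} {w})
    (unique∧⊆∧⊇⇒↭ (permutationSetoid (suc n)) (𝔖-unique (suc n)) unique (λ {v} _ → complete v) (λ {v} _ → 𝔖-complete v)))
  where
  open IsInsertion isIns
  L = cartesianProductWith ins (allFin (suc n)) (𝔖 n)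
  unique : Uniqueₚ L
  unique = SetoidUniqueₚ.cartesianProductWith⁺
    (setoid (Fin (suc n))) (permutationSetoid n) (permutationSetoid (suc n)) ins
    (λ {c} {d} {π} {ρ} → ins-injective {c} {d} {π} {ρ}) (allFin⁺ (suc n)) (𝔖-unique n)
  complete : ∀ w → w ∈ₚ L
  complete w with c , π , eq ← ins-surjective w =
    SetoidMembershipₚ.∈-resp-≈ (permutationSetoid (suc n)) {L} {ins c π} {w} eq
      (SetoidMembershipₚ.∈-cartesianProductWith⁺
        (setoid (Fin (suc n))) (permutationSetoid n) (permutationSetoid (suc n))
        (λ { {i} {j} {ρ} {τ} refl p → ins-cong {i} {ρ} {τ} p })
        (∈-allFin c) (𝔖-complete π))

-- Inserting 0 into the word and into the cycles.

-- `_≈_` compares forward maps only, whereas slots and gaps read the inverse.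
≈⇒≈ˡ : ∀ {v w : Permutation′ n} → v ≈ w → ∀ i → v ⟨$⟩ˡ i ≡ w ⟨$⟩ˡ i
≈⇒≈ˡ {v = v} {w} v≈w i = begin
  v ⟨$⟩ˡ i                       ≡⟨ cong (v ⟨$⟩ˡ_) (inverseʳ w) ⟨
  v ⟨$⟩ˡ (w ⟨$⟩ʳ (w ⟨$⟩ˡ i))     ≡⟨ cong (v ⟨$⟩ˡ_) (v≈w _) ⟨
  v ⟨$⟩ˡ (v ⟨$⟩ʳ (w ⟨$⟩ˡ i))     ≡⟨ inverseˡ v ⟩
  w ⟨$⟩ˡ i                       ∎
  where open ≡-Reasoning

-- The letter 0 is inserted into the word of π: in front if c = 0, else right
-- after the letter c − 1, which the insertion turns into c.
slot : Fin (suc n) → Permutation′ n → Fin (suc n)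
slot zero    π = zero
slot (suc a) π = suc (π ⟨$⟩ˡ a)

insertInWord : Fin (suc n) → Permutation′ n → Permutation′ (suc n)
insertInWord c π = insert (slot c π) zero π

-- The point 0 is inserted into the cycle of c − 1, or is fixed if c = 0.
insertInCycle : Fin (suc n) → Permutation′ n → Permutation′ (suc n)
insertInCycle c π = lift₀ π ∘ₚ transpose zero c

slot-cong : ∀ (c : Fin (suc n)) {π ρ} → π ≈ ρ → slot c π ≡ slot c ρ
slot-cong zero            π≈ρ = refl
slot-cong (suc a) {π} {ρ} π≈ρ = cong suc (≈⇒≈ˡ {v = π} {ρ} π≈ρ a)

slot-injective : ∀ (π : Permutation′ n) {c d} → slot c π ≡ slot d π → c ≡ d
slot-injective π {zero}  {zero}  eq = refl
slot-injective π {suc a} {suc b} eq = cong suc (begin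
  a                   ≡⟨ inverseʳ π ⟨
  π ⟨$⟩ʳ (π ⟨$⟩ˡ a)   ≡⟨ cong (π ⟨$⟩ʳ_) (Fin.suc-injective eq) ⟩
  π ⟨$⟩ʳ (π ⟨$⟩ˡ b)   ≡⟨ inverseʳ π ⟩
  b                   ∎)
  where open ≡-Reasoning

slot-surjective : ∀ (π : Permutation′ n) i → ∃ λ c → slot c π ≡ i
slot-surjective π zero    = zero , refl
slot-surjective π (suc p) = suc (π ⟨$⟩ʳ p) , cong suc (inverseˡ π)

insert-at : ∀ (i j : Fin (suc n)) π → insert i j π ⟨$⟩ʳ i ≡ j
insert-at i j π with i Fin.≟ i
... | yes _  = refl
... | no i≢i = contradiction refl i≢i

insertInWord-isInsertion : IsInsertion (insertInWord {n})
insertInWord-isInsertion {n} = record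
  { ins-cong       = λ {c} {π} {ρ} → insertInWord-cong {c} {π} {ρ}
  ; ins-injective  = λ {c} {d} {π} {ρ} → insertInWord-injective {c} {d} {π} {ρ}
  ; ins-surjective = insertInWord-surjective
  }
  where
  open ≡-Reasoning
  insertInWord-cong : ∀ {c π ρ} → π ≈ ρ → insertInWord c π ≈ insertInWord c ρ
  insertInWord-cong {c} {π} {ρ} π≈ρ i rewrite slot-cong c {π} {ρ} π≈ρ with slot c ρ Fin.≟ i
  ... | yes _ = refl
  ... | no  _ = cong suc (π≈ρ _)

  insertInWord-injective : ∀ {c d π ρ} → insertInWord c π ≈ insertInWord d ρ → c ≡ d × π ≈ ρ
  insertInWord-injective {c} {d} {π} {ρ} eq =
    -- A slot depends on the permutation as well as on the label, so `π≈ρ` is used to compare both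
    -- labels inside `ρ`.
    slot-injective ρ (trans (slot-cong c {ρ} {π} (λ i → sym (π≈ρ i))) same) , π≈ρ
    where
    same : slot c π ≡ slot d ρ
    -- The slot is the position of the letter 0, that is, the value of the inverse at 0.
    same = ≈⇒≈ˡ {v = insertInWord c π} {insertInWord d ρ} eq zero
    π≈ρ : π ≈ ρ
    π≈ρ k = Fin.suc-injective (begin
      suc (π ⟨$⟩ʳ k)                                    ≡⟨ insert-punchIn (slot c π) zero π k ⟨
      insertInWord c π ⟨$⟩ʳ punchIn (slot c π) k        ≡⟨ eq _ ⟩
      insertInWord d ρ ⟨$⟩ʳ punchIn (slot c π) k        ≡⟨ cong (λ i → insertInWord d ρ ⟨$⟩ʳ punchIn i k) same ⟩
      insertInWord d ρ ⟨$⟩ʳ punchIn (slot d ρ) k        ≡⟨ insert-punchIn (slot d ρ) zero ρ k ⟩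
      suc (ρ ⟨$⟩ʳ k)                                    ∎)

  insertInWord-surjective : ∀ w → ∃₂ λ c π → insertInWord c π ≈ w
  insertInWord-surjective w =
    let i        = w ⟨$⟩ˡ zero
        π        = remove i w
        c , slot≡ = slot-surjective π i
    in c , π , λ k → begin
      insert (slot c π) zero π ⟨$⟩ʳ k    ≡⟨ cong (λ j → insert j zero π ⟨$⟩ʳ k) slot≡ ⟩
      insert i zero π ⟨$⟩ʳ k             ≡⟨ cong (λ j → insert i j π ⟨$⟩ʳ k) (inverseʳ w) ⟨
      insert i (w ⟨$⟩ʳ i) π ⟨$⟩ʳ k       ≡⟨ insert-remove i w k ⟩
      w ⟨$⟩ʳ k                           ∎

transpose-matchʳ : ∀ (i j : Fin n) → PC.transpose i j j ≡ i
transpose-matchʳ i j with j Fin.≟ i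
... | yes j≡i = j≡i
... | no  _ rewrite dec-true (j Fin.≟ j) refl = refl

transpose-matchˡ : ∀ (i j : Fin n) → PC.transpose i j i ≡ j
transpose-matchˡ i j rewrite dec-true (i Fin.≟ i) refl = refl

transpose-other : ∀ {i j k : Fin n} → k ≢ i → k ≢ j → PC.transpose i j k ≡ k
transpose-other {i = i} {j} {k} k≢i k≢j
  rewrite dec-false (k Fin.≟ i) k≢i | dec-false (k Fin.≟ j) k≢j = refl

insertInCycle-isInsertion : IsInsertion (insertInCycle {n})
insertInCycle-isInsertion {n} = record
  { ins-cong       = λ {c} {π} {ρ} π≈ρ i → cong (PC.transpose zero c) (lift₀-cong π ρ π≈ρ i)
  ; ins-injective  = λ {c} {d} {π} {ρ} → insertInCycle-injective {c} {d} {π} {ρ}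
  ; ins-surjective = insertInCycle-surjective
  }
  where
  open ≡-Reasoning
  insertInCycle-injective : ∀ {c d π ρ} → insertInCycle c π ≈ insertInCycle d ρ → c ≡ d × π ≈ ρ
  -- The image of 0 under `insertInCycle c π` is `c`.
  insertInCycle-injective {c} {d} {π} {ρ} eq with refl ← eq zero =
    refl , λ k → Fin.suc-injective (begin
      suc (π ⟨$⟩ʳ k)                                               ≡⟨ PC.transpose-inverse c zero ⟨
      PC.transpose c zero (PC.transpose zero c (suc (π ⟨$⟩ʳ k)))   ≡⟨ cong (PC.transpose c zero) (eq (suc k)) ⟩
      PC.transpose c zero (PC.transpose zero c (suc (ρ ⟨$⟩ʳ k)))   ≡⟨ PC.transpose-inverse c zero ⟩
      suc (ρ ⟨$⟩ʳ k)                                               ∎)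

  insertInCycle-surjective : ∀ w → ∃₂ λ c π → insertInCycle c π ≈ w
  -- With `c` the image of 0, following `w` by the transposition of `c` and 0 fixes 0, so the result
  -- `w₀` is lifted from n points.
  insertInCycle-surjective w = c , remove zero w₀ , λ k → begin
    PC.transpose zero c (lift₀ (remove zero w₀) ⟨$⟩ʳ k)
      ≡⟨ cong (PC.transpose zero c) (lift₀-remove w₀ (transpose-matchˡ c zero) k) ⟩
    PC.transpose zero c (PC.transpose c zero (w ⟨$⟩ʳ k))
      ≡⟨ PC.transpose-inverse zero c ⟩
    w ⟨$⟩ʳ k
      ∎
    where
    c  = w ⟨$⟩ʳ zero
    w₀ = w ∘ₚ transpose c zero

-- Gap vectors and their behaviour under insertion.

-- Indexed by positions, and defined for arbitrary functions because the recursion passes to tails,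
-- which need not be words of permutations.
dropAfter : (Fin n → ℕ) → Fin n → ℕ
dropAfter {suc zero}    f zero    = 0
dropAfter {suc (suc n)} f zero    = f zero ∸ f (suc zero)
dropAfter {suc (suc n)} f (suc p) = dropAfter (f ∘ suc) p

dropAfter-cong : ∀ {f g : Fin n → ℕ} → f ≗ g → dropAfter f ≗ dropAfter g
dropAfter-cong {suc zero}    f≗g zero    = refl
dropAfter-cong {suc (suc n)} f≗g zero    = cong₂ _∸_ (f≗g zero) (f≗g (suc zero))
dropAfter-cong {suc (suc n)} f≗g (suc p) = dropAfter-cong (f≗g ∘ suc) p

dropAfter-≡0 : ∀ {f : Fin n → ℕ} {p} → f p ≡ 0 → dropAfter f p ≡ 0
dropAfter-≡0 {suc zero}    {p = zero}  fp≡0 = refl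
dropAfter-≡0 {suc (suc n)} {f} {zero}  fp≡0 = trans (cong (_∸ f (suc zero)) fp≡0) (ℕ.0∸n≡0 (f (suc zero)))
dropAfter-≡0 {suc (suc n)} {p = suc p} fp≡0 = dropAfter-≡0 {suc n} fp≡0

-- The word `f` raised by one with a 0 placed at `i`. Unlike `insert`, this relation makes sense for
-- the tails met in inductions on the position.
InsertedAt : Fin (suc n) → (f : Fin n → ℕ) (g : Fin (suc n) → ℕ) → Set
InsertedAt i f g = g i ≡ 0 × (∀ k → g (punchIn i k) ≡ suc (f k))

-- This position is directly before the new 0, so the drop is the whole raised letter.
dropAfter-before : ∀ {g : Fin (suc n) → ℕ} {f} p → InsertedAt (suc p) f g →
  dropAfter g (punchIn (suc p) p) ≡ suc (f p)
dropAfter-before {suc n}       zero    (gi≡0 , eq) rewrite gi≡0 = eq zero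
dropAfter-before {suc (suc n)} (suc p) (gi≡0 , eq) = dropAfter-before p (gi≡0 , eq ∘ suc)

-- Unless 0 comes right after it, a letter keeps its successor or stays last, and raising both
-- letters preserves their difference.
dropAfter-elsewhere : ∀ {g : Fin (suc n) → ℕ} {f} i k → InsertedAt i f g → i ≢ suc k →
  dropAfter g (punchIn i k) ≡ dropAfter f k
dropAfter-elsewhere {suc zero}    zero       zero    _ _  = refl
dropAfter-elsewhere {suc zero}    (suc zero) zero    _ ne = contradiction refl ne
dropAfter-elsewhere {suc (suc n)} zero       k       (_ , eq) _ = trans (dropAfter-cong eq k) (lowered k)
  where
  lowered : ∀ {m} {f : Fin m → ℕ} → dropAfter (suc ∘ f) ≗ dropAfter f
  lowered {suc zero}    zero    = refl
  lowered {suc (suc m)} zero    = refl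
  lowered {suc (suc m)} (suc k) = lowered k
dropAfter-elsewhere {suc (suc n)} (suc zero)    zero _ ne = contradiction refl ne
dropAfter-elsewhere {suc (suc n)} (suc (suc i)) zero (_ , eq) _ = cong₂ _∸_ (eq zero) (eq (suc zero))
dropAfter-elsewhere {suc (suc n)} (suc i) (suc k) (gi≡0 , eq) ne =
  dropAfter-elsewhere i k (gi≡0 , eq ∘ suc) (ne ∘ cong suc)

wordGap : Permutation′ n → Fin n → ℕ
wordGap w a = dropAfter (toℕ ∘ (w ⟨$⟩ʳ_)) (w ⟨$⟩ˡ a)

cycleGap : Permutation′ n → Fin n → ℕ
cycleGap w a = toℕ a ∸ toℕ (w ⟨$⟩ˡ a)

wordGap-cong : ∀ {v w : Permutation′ n} → v ≈ w → wordGap v ≗ wordGap w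
wordGap-cong {v = v} {w} v≈w a =
  trans (dropAfter-cong (cong toℕ ∘ v≈w) _) (cong (dropAfter _) (≈⇒≈ˡ {v = v} {w} v≈w a))

cycleGap-cong : ∀ {v w : Permutation′ n} → v ≈ w → cycleGap v ≗ cycleGap w
cycleGap-cong {v = v} {w} v≈w a = cong (λ i → toℕ a ∸ toℕ i) (≈⇒≈ˡ {v = v} {w} v≈w a)

-- For `c` = 0 the update writes 0 over the new 0, which covers the case where the old entries are
-- left alone.
extend : Fin (suc n) → Vec ℕ n → Vec ℕ (suc n)
extend c v = (0 ∷ v) [ c ]≔ toℕ c

tabulate-extend : ∀ (c : Fin (suc n)) {h : Fin n → ℕ} {g : Fin (suc n) → ℕ} →
  g zero ≡ 0 → g c ≡ toℕ c → (∀ a → suc a ≢ c → g (suc a) ≡ h a) →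
  Vec.tabulate g ≡ extend c (Vec.tabulate h)
tabulate-extend c {h} {g} g0 gc gsuc = trans (tabulate-cong pointwise) (tabulate∘lookup _)
  where
  v = 0 ∷ Vec.tabulate h
  pointwise : g ≗ lookup (v [ c ]≔ toℕ c)
  pointwise i with i Fin.≟ c
  pointwise i       | yes refl = trans gc (sym (lookup∘update i v _))
  pointwise zero    | no i≢c   = trans g0 (sym (lookup∘update′ i≢c v _))
  pointwise (suc a) | no i≢c   =
    trans (gsuc a i≢c) (trans (sym (lookup∘tabulate h a)) (sym (lookup∘update′ i≢c v _)))

wordGap-insert : ∀ (c : Fin (suc n)) π →
  Vec.tabulate (wordGap (insertInWord c π)) ≡ extend c (Vec.tabulate (wordGap π))
wordGap-insert c π = tabulate-extend c {g = wordGap (insertInWord c π)} (gap-0 c) (gap-c c) gap-suc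
  where
  inserted : ∀ c → InsertedAt (slot c π) (toℕ ∘ (π ⟨$⟩ʳ_)) (toℕ ∘ (insertInWord c π ⟨$⟩ʳ_))
  inserted c = cong toℕ (insert-at (slot c π) zero π) , λ k → cong toℕ (insert-punchIn (slot c π) zero π k)

  gap-0 : ∀ c → wordGap (insertInWord c π) zero ≡ 0
  gap-0 c = dropAfter-≡0 {p = slot c π} (proj₁ (inserted c))

  gap-c : ∀ c → wordGap (insertInWord c π) c ≡ toℕ c
  gap-c zero    = gap-0 zero
  gap-c (suc a) = trans (dropAfter-before (π ⟨$⟩ˡ a) (inserted (suc a))) (cong (suc ∘ toℕ) (inverseʳ π))

  gap-suc : ∀ a → suc a ≢ c → wordGap (insertInWord c π) (suc a) ≡ wordGap π a
  gap-suc a a≢c = dropAfter-elsewhere (slot c π) (π ⟨$⟩ˡ a) (inserted c)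
    (λ eq → a≢c (slot-injective π {suc a} {c} (sym eq)))

-- Only `c` and 0 change preimages relative to `lift₀ π`: the preimage of `c` becomes 0, giving gap
-- `c`, while the gap of 0 is truncated to 0.
cycleGap-insert : ∀ (c : Fin (suc n)) π →
  Vec.tabulate (cycleGap (insertInCycle c π)) ≡ extend c (Vec.tabulate (cycleGap π))
cycleGap-insert c π = tabulate-extend c {g = cycleGap (insertInCycle c π)} (ℕ.0∸n≡0 (toℕ (insertInCycle c π ⟨$⟩ˡ zero))) gap-c gap-suc
  where
  gap-c : cycleGap (insertInCycle c π) c ≡ toℕ c
  gap-c rewrite transpose-matchˡ c zero = refl

  gap-suc : ∀ a → suc a ≢ c → cycleGap (insertInCycle c π) (suc a) ≡ cycleGap π a
  gap-suc a a≢c rewrite transpose-other {j = zero} a≢c (λ ()) = refl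

-- Both insertions act through the same `extend`. Whole vectors are compared, since the effect of
-- overwriting an entry on the statistics depends on its old value.
wordGaps↭cycleGaps : ∀ n → map (Vec.tabulate ∘ wordGap) (𝔖 n) ↭ map (Vec.tabulate ∘ cycleGap) (𝔖 n)
wordGaps↭cycleGaps zero    = ↭-refl
wordGaps↭cycleGaps (suc n) = begin
  map (Vec.tabulate ∘ wordGap) (𝔖 (suc n))
    ↭⟨ map-𝔖-suc insertInWord-isInsertion (λ {v} {w} v≈w → tabulate-cong (wordGap-cong {v = v} {w} v≈w)) ⟩
  map (Vec.tabulate ∘ wordGap) (cartesianProductWith insertInWord cs (𝔖 n))
    ≡⟨ map-cartesianProductWith wordGap-insert cs (𝔖 n) ⟩
  cartesianProductWith extend cs (map (Vec.tabulate ∘ wordGap) (𝔖 n))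
    ↭⟨ cartesianProductWith-↭ʳ extend cs (wordGaps↭cycleGaps n) ⟩
  cartesianProductWith extend cs (map (Vec.tabulate ∘ cycleGap) (𝔖 n))
    ≡⟨ map-cartesianProductWith cycleGap-insert cs (𝔖 n) ⟨
  map (Vec.tabulate ∘ cycleGap) (cartesianProductWith insertInCycle cs (𝔖 n))
    ↭⟨ map-𝔖-suc insertInCycle-isInsertion (λ {v} {w} v≈w → tabulate-cong (cycleGap-cong {v = v} {w} v≈w)) ⟨
  map (Vec.tabulate ∘ cycleGap) (𝔖 (suc n))
    ∎
  where
  open PermutationReasoning
  cs = allFin (suc n)

-- The statistics as sums over gaps.

length-filter : {P : Pred A 0ℓ} (P? : Decidable P) {h : A → ℕ} →
  (∀ {x} → P x → h x ≡ 1) → (∀ {x} → ¬ P x → h x ≡ 0) →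
  ∀ xs → length (filter P? xs) ≡ List.sum (map h xs)
length-filter P? one none []       = refl
length-filter P? one none (x ∷ xs) with P? x
... | yes px rewrite one px   = cong suc (length-filter P? one none xs)
... | no ¬px rewrite none ¬px = length-filter P? one none xs

sum-map-filter : {P : Pred A 0ℓ} (P? : Decidable P) {h : A → ℕ} → (∀ {x} → ¬ P x → h x ≡ 0) →
  ∀ xs → List.sum (map h (filter P? xs)) ≡ List.sum (map h xs)
sum-map-filter P? none []       = refl
sum-map-filter P? {h} none (x ∷ xs) with P? x
... | yes _  = cong (h x +_) (sum-map-filter P? none xs)
... | no ¬px rewrite none ¬px = sum-map-filter P? none xs

sum-map-tabulate : ∀ {f : Fin n → A} {h : A → ℕ} → List.sum (map h (tabulate f)) ≡ sum (h ∘ f)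
sum-map-tabulate {zero}              = refl
sum-map-tabulate {suc n} {f = f} {h} = cong (h (f zero) +_) (sum-map-tabulate {n})

-- Together with the next lemma: `1 ⊓_` turns a truncated difference into the indicator of a strict
-- inequality, so counting descents or excedances becomes a sum over gaps.
1⊓[m∸n]≡1 : ∀ {m n} → n < m → 1 ⊓ (m ∸ n) ≡ 1
1⊓[m∸n]≡1 n<m = ℕ.m≤n⇒m⊓n≡m (ℕ.m<n⇒0<n∸m n<m)

1⊓[m∸n]≡0 : ∀ {m n} → ¬ n < m → 1 ⊓ (m ∸ n) ≡ 0
1⊓[m∸n]≡0 n≮m = cong (1 ⊓_) (ℕ.m≤n⇒m∸n≡0 (ℕ.≮⇒≥ n≮m))

-- The right side has one more term, for the last position, where the drop is 0; hence the condition
-- on `k`, later the identity or `1 ⊓_`.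
sum-consecutive : ∀ (k : ℕ → ℕ) → k 0 ≡ 0 → (f : Fin n → ℕ) →
  List.sum (map (λ (i , i⁺) → k (f i ∸ f i⁺)) (consecutive n)) ≡ sum (k ∘ dropAfter f)
sum-consecutive {zero}  k k0≡0 f = refl
sum-consecutive {suc m} k k0≡0 f = begin
  List.sum (map h (map (λ i → inject₁ i , suc i) (allFin m))) ≡⟨ cong List.sum (map-∘ (allFin m)) ⟨
  List.sum (map (λ i → h (inject₁ i , suc i)) (allFin m))     ≡⟨ sum-map-tabulate {m} ⟩
  sum (λ i → k (f (inject₁ i) ∸ f (suc i)))                   ≡⟨ sum-dropAfter m f ⟩
  sum (k ∘ dropAfter f)                                       ∎
  where
  open ≡-Reasoning
  h : Fin (suc m) × Fin (suc m) → ℕ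
  h (i , i⁺) = k (f i ∸ f i⁺)
  sum-dropAfter : ∀ m (f : Fin (suc m) → ℕ) →
    sum (λ i → k (f (inject₁ i) ∸ f (suc i))) ≡ sum (k ∘ dropAfter f)
  sum-dropAfter zero    f = sym (trans (ℕ.+-identityʳ (k 0)) k0≡0)
  sum-dropAfter (suc m) f = cong (k (f zero ∸ f (suc zero)) +_) (sum-dropAfter m (f ∘ suc))

sum-wordGap : ∀ (k : ℕ → ℕ) → k 0 ≡ 0 → (w : Permutation′ n) →
  List.sum (map (λ (i , i⁺) → k (toℕ (w ⟨$⟩ʳ i) ∸ toℕ (w ⟨$⟩ʳ i⁺))) (consecutive n)) ≡ sum (k ∘ wordGap w)
sum-wordGap k k0≡0 w = trans (sum-consecutive k k0≡0 f) (sum-permute (k ∘ dropAfter f) (flip w))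
  where
  f = toℕ ∘ (w ⟨$⟩ʳ_)

-- Substitution of a = w(i), which turns cycle gaps into the excesses of w(i) over i.
sum-cycleGap : ∀ (k : ℕ → ℕ) (w : Permutation′ n) →
  sum (k ∘ cycleGap w) ≡ sum (λ i → k (toℕ (w ⟨$⟩ʳ i) ∸ toℕ i))
sum-cycleGap k w = trans (sum-permute (k ∘ cycleGap w) w)
  (sum-cong-≗ (λ i → cong (λ j → k (toℕ (w ⟨$⟩ʳ i) ∸ toℕ j)) (inverseˡ w)))

des≡sum : ∀ (w : Permutation′ n) → des w ≡ sum ((1 ⊓_) ∘ wordGap w)
des≡sum {n} w = trans (length-filter _ 1⊓[m∸n]≡1 1⊓[m∸n]≡0 (consecutive n)) (sum-wordGap (1 ⊓_) refl w)

drops≡sum : ∀ (w : Permutation′ n) → drops w ≡ sum (wordGap w)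
drops≡sum {n} w = trans (sum-map-filter _ (ℕ.m≤n⇒m∸n≡0 ∘ ℕ.≮⇒≥) (consecutive n)) (sum-wordGap (λ x → x) refl w)

exc≡sum : ∀ (w : Permutation′ n) → exc w ≡ sum ((1 ⊓_) ∘ cycleGap w)
exc≡sum {n} w = begin
  exc w                                                              ≡⟨ length-filter _ 1⊓[m∸n]≡1 1⊓[m∸n]≡0 (allFin n) ⟩
  List.sum (map (λ i → 1 ⊓ (toℕ (w ⟨$⟩ʳ i) ∸ toℕ i)) (allFin n))     ≡⟨ sum-map-tabulate {n} ⟩
  sum (λ i → 1 ⊓ (toℕ (w ⟨$⟩ʳ i) ∸ toℕ i))                           ≡⟨ sum-cycleGap (1 ⊓_) w ⟨
  sum ((1 ⊓_) ∘ cycleGap w)                                          ∎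
  where open ≡-Reasoning

-- Lower bound for the depth.

sum-mono-≤ : ∀ {f g : Fin n → ℕ} → (∀ i → f i ≤ g i) → sum f ≤ sum g
sum-mono-≤ {zero}  f≤g = z≤n
sum-mono-≤ {suc n} f≤g = ℕ.+-mono-≤ (f≤g zero) (sum-mono-≤ (f≤g ∘ suc))

sum-≡0 : ∀ {f : Fin n → ℕ} → (∀ i → f i ≡ 0) → sum f ≡ 0
sum-≡0 {n} f≡0 = trans (sum-cong-≗ f≡0) (sum-replicate-zero n)

∸-triangle : ∀ m n o → m ∸ o ≤ (m ∸ n) + (n ∸ o)
∸-triangle m n o = ℕ.m≤n+o⇒m∸n≤o m o (begin
  m                         ≤⟨ ℕ.m≤n+m∸n m n ⟩
  n + (m ∸ n)               ≤⟨ ℕ.+-monoˡ-≤ (m ∸ n) (ℕ.m≤n+m∸n n o) ⟩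
  o + (n ∸ o) + (m ∸ n)     ≡⟨ ℕ.+-assoc o (n ∸ o) (m ∸ n) ⟩
  o + ((n ∸ o) + (m ∸ n))   ≡⟨ cong (o +_) (ℕ.+-comm (n ∸ o) (m ∸ n)) ⟩
  o + ((m ∸ n) + (n ∸ o))   ∎)
  where open ℕ.≤-Reasoning

transpose-≤ : ∀ {i j k : Fin n} → i Fin.< j → k ≢ i → PC.transpose i j k Fin.≤ k
transpose-≤ {i = i} {j} {k} i<j k≢i with k Fin.≟ j
... | yes refl rewrite transpose-matchʳ i k = ℕ.<⇒≤ i<j
... | no k≢j   rewrite transpose-other k≢i k≢j = ℕ.≤-refl

-- Only `i` moves up; `j` moves down and all other points are fixed.
sum-transpose : ∀ {i j : Fin n} → i Fin.< j → sum (λ x → toℕ (PC.transpose i j x) ∸ toℕ x) ≡ toℕ j ∸ toℕ i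
sum-transpose {suc n} {i} {j} i<j = begin
  sum excess                                  ≡⟨ sum-remove {i = i} excess ⟩
  excess i + sum (excess ∘ punchIn i)         ≡⟨ cong₂ _+_ (cong (λ k → toℕ k ∸ toℕ i) (transpose-matchˡ i j))
                                                   (sum-≡0 (λ k → ℕ.m≤n⇒m∸n≡0 (transpose-≤ i<j (Fin.punchInᵢ≢i i k)))) ⟩
  (toℕ j ∸ toℕ i) + 0                         ≡⟨ ℕ.+-identityʳ _ ⟩
  toℕ j ∸ toℕ i                               ∎
  where
  open ≡-Reasoning
  excess : Fin (suc n) → ℕ
  excess x = toℕ (PC.transpose i j x) ∸ toℕ x

-- Induction on the word. The triangle inequality splits off the first transposition `τ`: reindexing
-- by `τ` turns one sum into the excess of the remaining word, and the other is the depth of `τ`.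
excess≤totalDepth : ∀ (ts : TranspositionList n) → Increasing ts →
  sum (λ x → toℕ (eval ts ⟨$⟩ʳ x) ∸ toℕ x) ≤ totalDepth ts
excess≤totalDepth {n} []   []       = ℕ.≤-reflexive (sum-≡0 {n} (λ x → ℕ.n∸n≡0 (toℕ x)))
excess≤totalDepth {n} ((i , j) ∷ ts) (i<j ∷ inc) = begin
  sum (λ x → toℕ (ρ (τ x)) ∸ toℕ x)
    ≤⟨ sum-mono-≤ (λ x → ∸-triangle (toℕ (ρ (τ x))) (toℕ (τ x)) (toℕ x)) ⟩
  sum (λ x → (toℕ (ρ (τ x)) ∸ toℕ (τ x)) + (toℕ (τ x) ∸ toℕ x))
    ≡⟨ ∑-distrib-+ (λ x → toℕ (ρ (τ x)) ∸ toℕ (τ x)) _ ⟩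
  sum (λ x → toℕ (ρ (τ x)) ∸ toℕ (τ x)) + sum (λ x → toℕ (τ x) ∸ toℕ x)
    ≡⟨ cong₂ _+_ (sum-permute (λ x → toℕ (ρ x) ∸ toℕ x) (transpose i j)) (sym (sum-transpose i<j)) ⟨
  sum (λ x → toℕ (ρ x) ∸ toℕ x) + (toℕ j ∸ toℕ i)
    ≤⟨ ℕ.+-monoˡ-≤ _ (excess≤totalDepth ts inc) ⟩
  totalDepth ts + (toℕ j ∸ toℕ i)
    ≡⟨ ℕ.+-comm (totalDepth ts) _ ⟩
  (toℕ j ∸ toℕ i) + totalDepth ts
    ∎
  where
  open ℕ.≤-Reasoning
  ρ τ : Fin n → Fin n
  ρ = eval ts ⟨$⟩ʳ_
  τ = PC.transpose i j

-- Upper bound for the depth.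

-- The replaced entry is added on the left to avoid truncated subtraction.
sum-update : ∀ (v : Vec ℕ n) i x → sum (lookup (v [ i ]≔ x)) + lookup v i ≡ sum (lookup v) + x
sum-update (y ∷ v) zero x = begin
  x + s + y     ≡⟨ ℕ.+-comm (x + s) y ⟩
  y + (x + s)   ≡⟨ cong (y +_) (ℕ.+-comm x s) ⟩
  y + (s + x)   ≡⟨ ℕ.+-assoc y s x ⟨
  y + s + x     ∎
  where
  open ≡-Reasoning
  s = sum (lookup v)
sum-update (y ∷ v) (suc i) x = begin
  y + sum (lookup (v [ i ]≔ x)) + lookup v i     ≡⟨ ℕ.+-assoc y _ _ ⟩
  y + (sum (lookup (v [ i ]≔ x)) + lookup v i)   ≡⟨ cong (y +_) (sum-update v i x) ⟩
  y + (sum (lookup v) + x)                       ≡⟨ ℕ.+-assoc y _ x ⟨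
  y + sum (lookup v) + x                         ∎
  where open ≡-Reasoning

sum-tabulate : ∀ (k : ℕ → ℕ) (f : Fin n → ℕ) → sum (k ∘ lookup (Vec.tabulate f)) ≡ sum (k ∘ f)
sum-tabulate k f = sum-cong-≗ (cong k ∘ lookup∘tabulate f)

sum-cycleGap-insert : ∀ (c : Fin (suc n)) π →
  sum (cycleGap (insertInCycle c π)) + lookup (0 ∷ Vec.tabulate (cycleGap π)) c ≡ sum (cycleGap π) + toℕ c
sum-cycleGap-insert c π = begin
  sum (cycleGap (insertInCycle c π)) + lookup v c
    ≡⟨ cong (_+ lookup v c) (sum-tabulate (λ x → x) (cycleGap (insertInCycle c π))) ⟨
  sum (lookup (Vec.tabulate (cycleGap (insertInCycle c π)))) + lookup v c
    ≡⟨ cong (λ u → sum (lookup u) + lookup v c) (cycleGap-insert c π) ⟩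
  sum (lookup (v [ c ]≔ toℕ c)) + lookup v c
    ≡⟨ sum-update v c (toℕ c) ⟩
  sum (lookup v) + toℕ c
    ≡⟨ cong (_+ toℕ c) (sum-tabulate (λ x → x) (cycleGap π)) ⟩
  sum (cycleGap π) + toℕ c
    ∎
  where
  open ≡-Reasoning
  v = 0 ∷ Vec.tabulate (cycleGap π)

eval-++ : ∀ (ts us : TranspositionList n) → eval (ts ++ us) ≈ eval ts ∘ₚ eval us
eval-++ []             us k = refl
eval-++ ((i , j) ∷ ts) us k = eval-++ ts us (PC.transpose i j k)

totalDepth-++ : ∀ (ts us : TranspositionList n) → totalDepth (ts ++ us) ≡ totalDepth ts + totalDepth us
totalDepth-++ ts us = trans (cong List.sum (map-++ _ ts us)) (List.sum-++ (map _ ts) _)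

totalDepth-lift₀ : ∀ (ts : TranspositionList n) → totalDepth (TL.lift₀ ts) ≡ totalDepth ts
totalDepth-lift₀ ts = cong List.sum (sym (map-∘ ts))

increasing-lift₀ : ∀ {ts : TranspositionList n} → Increasing ts → Increasing (TL.lift₀ ts)
increasing-lift₀ = All.map⁺ ∘ All.map s<s

factors-resp-≈ : ∀ {v w : Permutation′ n} {d} → v ≈ w → FactorsWithDepth v d → FactorsWithDepth w d
factors-resp-≈ v≈w (ts , inc , v≈ts , depth≡) = ts , inc , (λ k → trans (sym (v≈w k)) (v≈ts k)) , depth≡

factors-lift₀ : ∀ {π : Permutation′ n} {d} → FactorsWithDepth π d → FactorsWithDepth (lift₀ π) d
factors-lift₀ {π = π} (ts , inc , π≈ts , depth≡) =
  TL.lift₀ ts , increasing-lift₀ inc ,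
  (λ k → trans (lift₀-cong π (eval ts) π≈ts k) (sym (eval-lift ts k))) ,
  trans (totalDepth-lift₀ ts) depth≡

factors-∘-transpose : ∀ {π : Permutation′ n} {d i j} → i Fin.< j → FactorsWithDepth π d →
  FactorsWithDepth (π ∘ₚ transpose i j) (d + (toℕ j ∸ toℕ i))
factors-∘-transpose {i = i} {j} i<j (ts , inc , π≈ts , refl) =
  ts ++ (i , j) ∷ [] , All.++⁺ inc (i<j ∷ []) ,
  (λ k → trans (cong (PC.transpose i j) (π≈ts k)) (sym (eval-++ ts ((i , j) ∷ []) k))) ,
  trans (totalDepth-++ ts ((i , j) ∷ [])) (cong (totalDepth ts +_) (ℕ.+-identityʳ _))

factors-transpose-∘ : ∀ {π : Permutation′ n} {d i j} → i Fin.< j → FactorsWithDepth π d →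
  FactorsWithDepth (transpose i j ∘ₚ π) (d + (toℕ j ∸ toℕ i))
factors-transpose-∘ {i = i} {j} i<j (ts , inc , π≈ts , refl) =
  (i , j) ∷ ts , i<j ∷ inc , π≈ts ∘ PC.transpose i j , ℕ.+-comm (toℕ j ∸ toℕ i) (totalDepth ts)

-- Conjugation of a transposition. It supplies the second description of `insertInCycle`, with a
-- transposition acting before `lift₀ π` instead of after it.
transpose-conj : ∀ (π : Permutation′ n) i j → transpose i j ∘ₚ π ≈ π ∘ₚ transpose (π ⟨$⟩ʳ i) (π ⟨$⟩ʳ j)
transpose-conj π i j k with k Fin.≟ i | k Fin.≟ j
... | yes refl | _        = sym (transpose-matchˡ (π ⟨$⟩ʳ i) (π ⟨$⟩ʳ j))
... | no k≢i   | yes refl rewrite dec-true (k Fin.≟ k) refl = sym (transpose-matchʳ (π ⟨$⟩ʳ i) (π ⟨$⟩ʳ j))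
... | no k≢i   | no k≢j   rewrite dec-false (k Fin.≟ j) k≢j =
  sym (transpose-other (k≢i ∘ π-injective) (k≢j ∘ π-injective))
  where
  π-injective : ∀ {x y} → π ⟨$⟩ʳ x ≡ π ⟨$⟩ʳ y → x ≡ y
  π-injective eq = trans (sym (inverseˡ π)) (trans (cong (π ⟨$⟩ˡ_) eq) (inverseˡ π))

factors-insertInCycle : ∀ (c : Fin (suc n)) {π} → FactorsWithDepth π (sum (cycleGap π)) →
  FactorsWithDepth (insertInCycle c π) (sum (cycleGap (insertInCycle c π)))
-- Here the transposition of 0 with itself is trivial, so a lifted factorization suffices.
factors-insertInCycle zero {π} fs = subst (FactorsWithDepth (insertInCycle zero π)) depth≡
  (factors-resp-≈ {v = lift₀ π} {insertInCycle zero π} lift₀≈ (factors-lift₀ {π = π} fs))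
  where
  lift₀≈ : lift₀ π ≈ insertInCycle zero π
  lift₀≈ zero    = refl
  lift₀≈ (suc k) = refl
  depth≡ : sum (cycleGap π) ≡ sum (cycleGap (insertInCycle zero π))
  depth≡ = ℕ.+-cancelʳ-≡ 0 _ _ (sym (sum-cycleGap-insert zero π))
factors-insertInCycle (suc a) {π} fs with toℕ (π ⟨$⟩ˡ a) ℕ.≤? toℕ a
-- The old entry a - p is replaced by a + 1, a gain of p + 1: the depth of (0 p+1), multiplied on
-- the side acting first.
... | yes p≤a = subst (FactorsWithDepth (insertInCycle (suc a) π)) depth≡
  (factors-resp-≈ {v = transpose zero (suc p) ∘ₚ lift₀ π} {insertInCycle (suc a) π} conj
    (factors-transpose-∘ {π = lift₀ π} {i = zero} {suc p} z<s (factors-lift₀ {π = π} fs)))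
  where
  p = π ⟨$⟩ˡ a
  conj : transpose zero (suc p) ∘ₚ lift₀ π ≈ insertInCycle (suc a) π
  conj k = trans (transpose-conj (lift₀ π) zero (suc p) k)
    (cong (λ b → PC.transpose zero (suc b) (lift₀ π ⟨$⟩ʳ k)) (inverseʳ π))
  depth≡ : sum (cycleGap π) + suc (toℕ p) ≡ sum (cycleGap (insertInCycle (suc a) π))
  depth≡ = ℕ.+-cancelʳ-≡ (cycleGap π a) _ _ (begin
    sum (cycleGap π) + suc (toℕ p) + (toℕ a ∸ toℕ p)     ≡⟨ ℕ.+-assoc (sum (cycleGap π)) _ _ ⟩
    sum (cycleGap π) + suc (toℕ p + (toℕ a ∸ toℕ p))     ≡⟨ cong (λ x → sum (cycleGap π) + suc x) (ℕ.m+[n∸m]≡n p≤a) ⟩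
    sum (cycleGap π) + suc (toℕ a)                       ≡⟨ sum-cycleGap-insert (suc a) π ⟨
    sum (cycleGap (insertInCycle (suc a) π)) + lookup (Vec.tabulate (cycleGap π)) a
      ≡⟨ cong (sum (cycleGap (insertInCycle (suc a) π)) +_) (lookup∘tabulate (cycleGap π) a) ⟩
    sum (cycleGap (insertInCycle (suc a) π)) + cycleGap π a ∎)
    where open ≡-Reasoning
-- The old entry is 0, so the gain is a + 1: the depth of (0 a+1), multiplied on the side acting
-- last.
... | no p≰a = subst (FactorsWithDepth (insertInCycle (suc a) π)) depth≡
  (factors-∘-transpose {π = lift₀ π} {i = zero} {suc a} z<s (factors-lift₀ {π = π} fs))
  where
  depth≡ : sum (cycleGap π) + suc (toℕ a) ≡ sum (cycleGap (insertInCycle (suc a) π))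
  depth≡ = begin
    sum (cycleGap π) + suc (toℕ a)                       ≡⟨ sum-cycleGap-insert (suc a) π ⟨
    sum (cycleGap (insertInCycle (suc a) π)) + lookup (Vec.tabulate (cycleGap π)) a
      ≡⟨ cong (sum (cycleGap (insertInCycle (suc a) π)) +_) (lookup∘tabulate (cycleGap π) a) ⟩
    sum (cycleGap (insertInCycle (suc a) π)) + cycleGap π a
      ≡⟨ cong (sum (cycleGap (insertInCycle (suc a) π)) +_) (ℕ.m≤n⇒m∸n≡0 (ℕ.≰⇒≥ p≰a)) ⟩
    sum (cycleGap (insertInCycle (suc a) π)) + 0         ≡⟨ ℕ.+-identityʳ _ ⟩
    sum (cycleGap (insertInCycle (suc a) π))             ∎
    where open ≡-Reasoning

-- Every permutation is built from the empty one by cycle insertions, each paid for by at most one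
-- transposition of the right depth.
factors-cycleGap : ∀ (w : Permutation′ n) → FactorsWithDepth w (sum (cycleGap w))
factors-cycleGap {zero}  w = [] , [] , (λ ()) , refl
factors-cycleGap {suc n} w
  with c , π , ins≈w ← IsInsertion.ins-surjective insertInCycle-isInsertion w =
  subst (FactorsWithDepth w) (sum-cong-≗ (cycleGap-cong {v = insertInCycle c π} {w} ins≈w))
    (factors-resp-≈ {v = insertInCycle c π} {w} ins≈w (factors-insertInCycle c (factors-cycleGap π)))

dp≡sum : ∀ (w : Permutation′ n) → dp w ≡ sum (cycleGap w)
dp≡sum w with dp-isMinimum w
... | (ts , inc , w≈ts , depth≡) , min = ℕ.≤-antisym (min _ (factors-cycleGap w)) (begin
  sum (cycleGap w)                                ≡⟨ sum-cycleGap (λ x → x) w ⟩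
  sum (λ x → toℕ (w ⟨$⟩ʳ x) ∸ toℕ x)              ≡⟨ sum-cong-≗ (λ x → cong (λ y → toℕ y ∸ toℕ x) (w≈ts x)) ⟩
  sum (λ x → toℕ (eval ts ⟨$⟩ʳ x) ∸ toℕ x)        ≤⟨ excess≤totalDepth ts inc ⟩
  totalDepth ts                                   ≡⟨ depth≡ ⟩
  dp w                                            ∎)
  where open ℕ.≤-Reasoning

-- Equidistribution of the pairs of statistics.

-- Both pairs are values of the single function `sums`, at the word gaps and at the cycle gaps.
drops-des↭dp-exc : ∀ n → map (λ w → drops w , des w) (𝔖 n) ↭ map (λ w → dp w , exc w) (𝔖 n)
drops-des↭dp-exc n = begin
  map (λ w → drops w , des w) (𝔖 n)                       ≡⟨ map-cong (λ w → factor (drops≡sum w) (des≡sum w)) (𝔖 n) ⟩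
  map (sums ∘ Vec.tabulate ∘ wordGap) (𝔖 n)               ≡⟨ map-∘ (𝔖 n) ⟩
  map sums (map (Vec.tabulate ∘ wordGap) (𝔖 n))           ↭⟨ ↭.map⁺ sums (wordGaps↭cycleGaps n) ⟩
  map sums (map (Vec.tabulate ∘ cycleGap) (𝔖 n))          ≡⟨ map-∘ (𝔖 n) ⟨
  map (sums ∘ Vec.tabulate ∘ cycleGap) (𝔖 n)              ≡⟨ map-cong (λ w → factor (dp≡sum w) (exc≡sum w)) (𝔖 n) ⟨
  map (λ w → dp w , exc w) (𝔖 n)                          ∎
  where
  open PermutationReasoning
  sums : Vec ℕ n → ℕ × ℕ
  sums v = sum (lookup v) , sum ((1 ⊓_) ∘ lookup v)
  factor : ∀ {a b} {f : Fin n → ℕ} → a ≡ sum f → b ≡ sum ((1 ⊓_) ∘ f) → (a , b) ≡ sums (Vec.tabulate f)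
  factor {f = f} p q = cong₂ _,_ (trans p (sym (sum-tabulate (λ x → x) f))) (trans q (sym (sum-tabulate (1 ⊓_) f)))

coeff-∑ : ∀ (xs : List A) (f : A → Polynomial) a b → coeff (∑[ x ∈ xs ] f x) a b ≡ List.sum (map (λ x → coeff (f x) a b) xs)
coeff-∑ []       f a b = refl
coeff-∑ (x ∷ xs) f a b = cong (coeff (f x) a b +_) (coeff-∑ xs f a b)

theorem1p3 : (n : ℕ) → n ≥ 1 →
    (∑[ w ∈ 𝔖 n ] q^ drops w t^ des w) ≈ₚ (∑[ w ∈ 𝔖 n ] q^ dp w t^ exc w)
    × (∀ k → length (filter (λ w → dp w ≟ k) (𝔖 n)) ≡ length (filter (λ w → drops w ≟ k) (𝔖 n)))
theorem1p3 n _ = polynomials , counts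
  where
  open ≡-Reasoning
  -- Both claims are instances: `h` is a coefficient of the monomial with the given exponents, or
  -- the indicator that the first component equals `k`.
  sum-statistics : ∀ (h : ℕ × ℕ → ℕ) →
    List.sum (map (λ w → h (drops w , des w)) (𝔖 n)) ≡ List.sum (map (λ w → h (dp w , exc w)) (𝔖 n))
  sum-statistics h = begin
    List.sum (map (λ w → h (drops w , des w)) (𝔖 n))         ≡⟨ cong List.sum (map-∘ (𝔖 n)) ⟩
    List.sum (map h (map (λ w → drops w , des w) (𝔖 n)))     ≡⟨ List.sum-↭ (↭.map⁺ h (drops-des↭dp-exc n)) ⟩
    List.sum (map h (map (λ w → dp w , exc w) (𝔖 n)))        ≡⟨ cong List.sum (map-∘ (𝔖 n)) ⟨
    List.sum (map (λ w → h (dp w , exc w)) (𝔖 n))            ∎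

  polynomials : (∑[ w ∈ 𝔖 n ] q^ drops w t^ des w) ≈ₚ (∑[ w ∈ 𝔖 n ] q^ dp w t^ exc w)
  polynomials a b = begin
    coeff (∑[ w ∈ 𝔖 n ] q^ drops w t^ des w) a b                        ≡⟨ coeff-∑ (𝔖 n) (λ w → q^ drops w t^ des w) a b ⟩
    List.sum (map (λ w → coeff (q^ drops w t^ des w) a b) (𝔖 n))        ≡⟨ sum-statistics (λ (c , d) → coeff (q^ c t^ d) a b) ⟩
    List.sum (map (λ w → coeff (q^ dp w t^ exc w) a b) (𝔖 n))           ≡⟨ coeff-∑ (𝔖 n) (λ w → q^ dp w t^ exc w) a b ⟨
    coeff (∑[ w ∈ 𝔖 n ] q^ dp w t^ exc w) a b                           ∎

  counts : ∀ k → length (filter (λ w → dp w ≟ k) (𝔖 n)) ≡ length (filter (λ w → drops w ≟ k) (𝔖 n))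
  counts k = begin
    length (filter (λ w → dp w ≟ k) (𝔖 n))                ≡⟨ count dp ⟩
    List.sum (map (λ w → indicator (dp w)) (𝔖 n))         ≡⟨ sum-statistics (indicator ∘ proj₁) ⟨
    List.sum (map (λ w → indicator (drops w)) (𝔖 n))      ≡⟨ count drops ⟨
    length (filter (λ w → drops w ≟ k) (𝔖 n))             ∎
    where
    indicator : ℕ → ℕ
    indicator c = if does (c ≟ k) then 1 else 0
    count : ∀ (f : Permutation′ n → ℕ) → length (filter (λ w → f w ≟ k) (𝔖 n)) ≡ List.sum (map (indicator ∘ f) (𝔖 n))
    count f = length-filter (λ w → f w ≟ k)
      (λ eq → cong (λ b → if b then 1 else 0) (dec-true (_ ≟ k) eq))
      (λ ne → cong (λ b → if b then 1 else 0) (dec-false (_ ≟ k) ne)) (𝔖 n)
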